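{- For all integers $m \ge n \ge 1$, $$\gamma_c(G(n,m)) = \begin{cases} \left\lceil \dfrac{m}{2} \right\rceil + 1, & \text{if } n=2 \text{ and } m \text{ is odd},\\[0.6em] \left\lfloor \dfrac{m}{2} \right\rfloor + 1, & \text{otherwise}.\end{cases}$$
   Context: For integers $n,m\ge 1$, the grid $G(n,m)$ has cell set $V_{n,m}=\{(i,j): 1\le i\le n,\ 1\le j\le m\}$ ($i$ = row, $j$ = column). Contamination rules: a cell $u=(i,j)\in V_{n,m}$ can be contaminated by two contaminated cells $v,w\in V_{n,m}$ if one of the following holds: (a) $v=(i-1,j-1)$, $w=(i+1,j+1)$; (b) $v=(i+1,j-1)$, $w=(i-1,j+1)$; (c) $v=(i-1,j)$, $w=(i+1,j)$; (d) $v=(i,j-1)$, $w=(i,j+1)$; (e) $v=(i,j-1)$, $w=(i-1,j)$; (f) $v=(i,j-1)$, $w=(i+1,j)$; (g) $v=(i+1,j)$, $w=(i,j+1)$; (h) $v=(i-1,j)$, $w=(i,j+1)$. For $S\subseteq V_{n,m}$, the final contaminated set $C(S)$ is obtained by starting from $S$ and repeatedly adding cells that can be contaminated by two already contaminated cells, until no more can be added; equivalently, $C(S)$ is the smallest subset of $V_{n,m}$ containing $S$ and closed under rules (a)--(h). $S$ is a contaminating set (it fully contaminates the grid) if $C(S)=V_{n,m}$. The power contamination number $\gamma_c(G(n,m))$ is the minimum cardinality of a contaminating set. -}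

module Defs where

open import Data.Fin.Base using (Fin; toℕ)
open import Data.List.Base using (List; length)
open import Data.List.Membership.Propositional using (_∈_)
open import Data.List.Relation.Unary.Unique.Propositional using (Unique)
open import Data.Nat.Base using (ℕ; suc; _≤_)
open import Data.Product.Base using (_×_; _,_; ∃-syntax)
open import Level using (0ℓ)
open import Relation.Binary.PropositionalEquality using (_≡_)
open import Relation.Unary using (Pred)

private
  variable
    n m : ℕ

-- Cells are pairs (row , column), numbered from 0 rather than from 1; the
-- contamination rules only depend on relative positions.
Cell : ℕ → ℕ → Set
Cell n m = Fin n × Fin m

infix 4 _⋖_

-- i ⋖ j means j = i + 1, with both inside the grid.
_⋖_ : Fin n → Fin n → Set
i ⋖ j = suc (toℕ i) ≡ toℕ j

-- Contaminates v w u: the cells v and w, once contaminated, can contaminate u.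
-- The names i⁻, i, i⁺ stand for i - 1, i, i + 1 (likewise for j).
data Contaminates {n m : ℕ} : (v w u : Cell n m) → Set where
  rule-a : ∀ {i⁻ i i⁺ j⁻ j j⁺} → i⁻ ⋖ i → i ⋖ i⁺ → j⁻ ⋖ j → j ⋖ j⁺ →
           Contaminates (i⁻ , j⁻) (i⁺ , j⁺) (i , j)
  rule-b : ∀ {i⁻ i i⁺ j⁻ j j⁺} → i⁻ ⋖ i → i ⋖ i⁺ → j⁻ ⋖ j → j ⋖ j⁺ →
           Contaminates (i⁺ , j⁻) (i⁻ , j⁺) (i , j)
  rule-c : ∀ {i⁻ i i⁺ j} → i⁻ ⋖ i → i ⋖ i⁺ →
           Contaminates (i⁻ , j) (i⁺ , j) (i , j)
  rule-d : ∀ {i j⁻ j j⁺} → j⁻ ⋖ j → j ⋖ j⁺ →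
           Contaminates (i , j⁻) (i , j⁺) (i , j)
  rule-e : ∀ {i⁻ i j⁻ j} → i⁻ ⋖ i → j⁻ ⋖ j →
           Contaminates (i , j⁻) (i⁻ , j) (i , j)
  rule-f : ∀ {i i⁺ j⁻ j} → i ⋖ i⁺ → j⁻ ⋖ j →
           Contaminates (i , j⁻) (i⁺ , j) (i , j)
  rule-g : ∀ {i i⁺ j j⁺} → i ⋖ i⁺ → j ⋖ j⁺ →
           Contaminates (i⁺ , j) (i , j⁺) (i , j)
  rule-h : ∀ {i⁻ i j j⁺} → i⁻ ⋖ i → j ⋖ j⁺ →
           Contaminates (i⁻ , j) (i , j⁺) (i , j)

-- The final contaminated set: the least set of cells containing S and closed
-- under the rules.
data C (S : List (Cell n m)) : Pred (Cell n m) 0ℓ where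
  initial : ∀ {u} → u ∈ S → C S u
  spread  : ∀ {u v w} → Contaminates v w u → C S v → C S w → C S u

-- A set of cells is a duplicate-free list, so that its cardinality is its
-- length.
record IsContaminatingSet (S : List (Cell n m)) : Set where
  field
    unique      : Unique S
    contaminate : ∀ u → C S u

record IsPowerContaminationNumber (n m k : ℕ) : Set where
  field
    attained : ∃[ S ] IsContaminatingSet {n} {m} S × length S ≡ k
    minimal  : ∀ (S : List (Cell n m)) → IsContaminatingSet S → k ≤ length S

{-# OPTIONS --safe #-}
module Submission where

-- Upper bound: a filled rectangle with corner cell (r , c) advances to columns
-- c + 2 and to row r, r + 1 (if r > 0) or r + 2 by one seed at the new corner.
--
-- Lower bound: projected to columns, contamination enters a set of columns
-- without isolated interior members only if a seed lies in it, so each of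
-- 0 | 1 2 | 3 4 | … contains a seed.  For two rows and an odd number of
-- columns, a seed in an odd column or two seeds in an even column make one
-- further seed necessary; without either, the contamination gets stuck.

open import Data.Bool.Base using (if_then_else_)
open import Data.Empty using (⊥)
open import Data.Fin.Base using (Fin; zero; suc; toℕ; fromℕ<)
open import Data.Fin.Properties using (toℕ-fromℕ<; toℕ<n; toℕ-injective; injective⇒≤)
  renaming (_≟_ to _≟ᶠ_)
open import Data.List.Base using (List; []; _∷_; length; lookup)
open import Data.List.Membership.Propositional using (_∈_)
open import Data.List.Relation.Unary.All as All using (All; []; _∷_)
open import Data.List.Relation.Unary.AllPairs using ([]; _∷_)
open import Data.List.Relation.Unary.Any using (here; there; index)
open import Data.List.Relation.Unary.Any.Properties using (lookup-index)
open import Data.List.Relation.Unary.Unique.Propositional using (Unique)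
open import Data.Nat.Base using (ℕ; zero; suc; _+_; _*_; _≤_; _<_; z≤n; s≤s; s≤s⁻¹;
  ⌊_/2⌋; ⌈_/2⌉)
open import Data.Nat.DivMod using (_%_; m*n%n≡0; [m+kn]%n≡m%n)
open import Data.Nat.Properties
  using (_≟_; _≤?_; ≤-refl; ≤-trans; ≤-reflexive; <⇒≤; <⇒≱; n≤1+n; m≤n+m; m≤n⇒m<n∨m≡n; 1+n≢n;
         +-comm; +-suc; +-identityʳ; suc-injective; m≤m*n; *-monoˡ-≤; *-cancelʳ-<)
open import Data.Product.Base using (_×_; _,_; ∃-syntax; proj₁; proj₂)
open import Data.Product.Properties using (≡-dec)
open import Data.Sum.Base using (_⊎_; inj₁; inj₂; map)
open import Function.Base using (_∘_; flip)
open import Relation.Binary.PropositionalEquality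
  using (_≡_; _≢_; refl; sym; trans; cong; subst)
open import Relation.Nullary.Decidable using (Dec; yes; no; does; _×-dec_; decidable-stable)
open import Relation.Nullary.Negation using (contradiction)
open import Defs

private
  variable
    n m r c k : ℕ
    i j : ℕ
    u v w : Cell n m
    S S′ : List (Cell n m)
    P : ℕ → ℕ → Set

-- Filling rectangles under the spreading rules

Near : ℕ → ℕ → Set
Near i i′ = suc i ≡ i′ ⊎ suc i′ ≡ i

-- The four sign choices in the two `Near` hypotheses are rules (e) to (h).
CornerClosed : (ℕ → ℕ → Set) → Set
CornerClosed P = ∀ {i i′ j j′} → Near i i′ → Near j j′ → P i j′ → P i′ j → P i j

record SpreadClosed (P : ℕ → ℕ → Set) : Set where
  field
    corner     : CornerClosed P
    horizontal : P i j → P i (2 + j) → P i (1 + j)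
    diagonal   : P i j → P (2 + i) (2 + j) → P (1 + i) (1 + j)

Full : (ℕ → ℕ → Set) → ℕ → ℕ → Set
Full P r c = ∀ {i j} → i ≤ r → j ≤ c → P i j

-- Next to a full column the corner rules carry contamination one row up or down: the given cell
-- climbs to row 0, and from there the column fills downward.
growColumn : CornerClosed P → Full P r c → i ≤ r → P i (suc c) → Full P r (suc c)
growColumn {P = P} {r = r} {c = c} corner full i≤r p {j = j} i′≤r j≤1+c
  with m≤n⇒m<n∨m≡n j≤1+c
... | inj₁ j<1+c = full i′≤r (s≤s⁻¹ j<1+c)
... | inj₂ refl  = down i′≤r
  where
  toTop : i ≤ r → P i (suc c) → P 0 (suc c)
  toTop {zero}  _   p = p
  toTop {suc i} i<r p =
    toTop (<⇒≤ i<r) (corner (inj₁ refl) (inj₂ refl) (full (<⇒≤ i<r) ≤-refl) p)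

  down : i ≤ r → P i (suc c)
  down {zero}  _   = toTop i≤r p
  down {suc i} i<r = corner (inj₂ refl) (inj₂ refl) (full i<r ≤-refl) (down (<⇒≤ i<r))

growRow : CornerClosed P → Full P r c → j ≤ c → P (suc r) j → Full P (suc r) c
growRow corner full j≤c p = flip (growColumn (λ x y q q′ → corner y x q′ q) (flip full) j≤c p)

module _ (closed : SpreadClosed P) where
  open SpreadClosed closed

  fillColumn : Full P r c → P r (1 + c) → Full P r (1 + c)
  fillColumn full = growColumn corner full ≤-refl

  fillCorner : Full P r c → P (1 + r) (1 + c) → Full P (1 + r) (1 + c)
  fillCorner full p = fillColumn (growRow corner full ≤-refl q) p
    -- The cell left of the new corner, which starts the new row.
    where q = corner (inj₂ refl) (inj₁ refl) p (full ≤-refl ≤-refl)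

  fillCorner₀₂ : Full P r c → P r (2 + c) → Full P r (2 + c)
  fillCorner₀₂ full p = fillColumn (fillColumn full q) p
    where q = horizontal (full ≤-refl ≤-refl) p

  -- The diagonal rule pairs the new corner with the cell one row above the old corner, so the old
  -- rectangle must have at least two rows.
  fillCorner₁₂ : Full P (1 + r) c → P (2 + r) (2 + c) → Full P (2 + r) (2 + c)
  fillCorner₁₂ full p = fillColumn (growRow corner full′ ≤-refl q) p
    where
    full′ = fillColumn full (diagonal (full (n≤1+n _) ≤-refl) p)
    q = corner (inj₂ refl) (inj₁ refl) p (full′ ≤-refl ≤-refl)

  fillCorner₂₂ : Full P r c → P (2 + r) (2 + c) → Full P (2 + r) (2 + c)
  fillCorner₂₂ full p = fillColumn (growRow corner full′ ≤-refl q) p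
    where
    full′ = fillCorner full (diagonal (full ≤-refl ≤-refl) p)
    q = corner (inj₂ refl) (inj₁ refl) p (full′ ≤-refl ≤-refl)

-- Numerical coordinates; a contaminated position lies in the grid by
-- definition, so the rules need no side conditions on bounds.
At : List (Cell n m) → ℕ → ℕ → Set
At {n} {m} S i j = ∃[ x ] ∃[ y ] (toℕ {n} x ≡ i) × (toℕ {m} y ≡ j) × C S (x , y)

between : (x z : Fin n) → suc (suc (toℕ x)) ≡ toℕ z → ∃[ y ] (x ⋖ y × y ⋖ z)
between x z eq = fromℕ< lt , sym (toℕ-fromℕ< lt) , trans (cong suc (toℕ-fromℕ< lt)) eq
  where lt = <⇒≤ (subst (_< _) (sym eq) (toℕ<n z))

At-closed : SpreadClosed (At S)
At-closed = record { corner = corner ; horizontal = horizontal ; diagonal = diagonal }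
  where
  corner : CornerClosed (At S)
  corner a b (x , y′ , refl , refl , p) (x′ , y , refl , refl , q) =
    x , y , refl , refl , cell a b p q
    where
    cell : ∀ {x x′ y y′} → Near (toℕ x) (toℕ x′) → Near (toℕ y) (toℕ y′) →
           C S (x , y′) → C S (x′ , y) → C S (x , y)
    cell (inj₁ a) (inj₁ b) p q = spread (rule-g a b) q p
    cell (inj₁ a) (inj₂ b) p q = spread (rule-f a b) p q
    cell (inj₂ a) (inj₁ b) p q = spread (rule-h a b) q p
    cell (inj₂ a) (inj₂ b) p q = spread (rule-e a b) p q

  horizontal : At S i j → At S i (2 + j) → At S i (1 + j)
  horizontal (x , y , refl , refl , p) (x″ , y″ , x″≡x , eq , p″)
    with refl ← toℕ-injective x″≡x | y′ , a , b ← between y y″ (sym eq) =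
    x , y′ , refl , sym a , spread (rule-d a b) p p″

  diagonal : At S i j → At S (2 + i) (2 + j) → At S (1 + i) (1 + j)
  diagonal (x , y , refl , refl , p) (x″ , y″ , eqˣ , eqʸ , p″)
    with x′ , a , b ← between x x″ (sym eqˣ) | y′ , a′ , b′ ← between y y″ (sym eqʸ) =
    x′ , y′ , sym a , sym a′ , spread (rule-a a b a′ b′) p p″

C-mono : (∀ {u} → u ∈ S → u ∈ S′) → C S u → C S′ u
C-mono S⊆S′ (initial u∈S)  = initial (S⊆S′ u∈S)
C-mono S⊆S′ (spread r p q) = spread r (C-mono S⊆S′ p) (C-mono S⊆S′ q)

-- Upper bound: seed sets built corner by corner

record Filled (n m r c k : ℕ) : Set where
  field
    seeds   : List (Cell n m)
    unique  : Unique seeds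
    size    : length seeds ≡ k
    bounded : All (λ u → toℕ (proj₂ u) ≤ c) seeds
    full    : Full (At seeds) r c

-- `fill` is required for every closed `P` so that it applies to the enlarged seed list, to which
-- `C-mono` carries the old rectangle.
addSeed : ∀ {r′ c′} → r′ < n → c < c′ → c′ < m →
          (∀ {P} → SpreadClosed P → Full P r c → P r′ c′ → Full P r′ c′) →
          Filled n m r c k → Filled n m r′ c′ (suc k)
addSeed {r = r} {r′ = r′} {c′ = c′} r′<n c<c′ c′<m fill F = record
  { seeds   = s ∷ seeds
  -- Old seeds lie in columns up to `c < c′`, so the new one differs from each of them.
  ; unique  = All.map (λ { u≤c refl → <⇒≱ c<c′ (subst (_≤ _) (toℕ-fromℕ< c′<m) u≤c) }) bounded
              ∷ unique
  ; size    = cong suc size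
  ; bounded = ≤-reflexive (toℕ-fromℕ< c′<m) ∷ All.map (λ u≤c → ≤-trans u≤c (<⇒≤ c<c′)) bounded
  ; full    = fill At-closed
                (λ i≤r j≤c → let x , y , a , b , p = full i≤r j≤c in x , y , a , b , C-mono there p)
                (_ , _ , toℕ-fromℕ< r′<n , toℕ-fromℕ< c′<m , initial (here refl))
  }
  where
  open Filled F
  s = fromℕ< r′<n , fromℕ< c′<m

filledCell : Filled (suc n) (suc m) 0 0 1
filledCell = record
  { seeds   = (zero , zero) ∷ []
  ; unique  = [] ∷ []
  ; size    = refl
  ; bounded = z≤n ∷ []
  ; full    = λ { z≤n z≤n → zero , zero , refl , refl , initial (here refl) }
  }

ContaminatingOfSize : ℕ → ℕ → ℕ → Set
ContaminatingOfSize n m k = ∃[ S ] IsContaminatingSet {n} {m} S × length S ≡ k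

filledGrid : Filled (suc r) (suc c) r c k → ContaminatingOfSize (suc r) (suc c) k
filledGrid F = seeds , record { unique = unique ; contaminate = all } , size
  where
  open Filled F
  all : ∀ u → C seeds u
  all (x , y) with full (s≤s⁻¹ (toℕ<n x)) (s≤s⁻¹ (toℕ<n y))
  ... | x′ , y′ , a , b , p with refl ← toℕ-injective a | refl ← toℕ-injective b = p

-- `d` rows are missing, and `e` seeds worth two columns each are to come. Rows are gained in pairs
-- while two are missing; `d ≤ e * 2` leaves enough seeds, and a single missing row needs `0 < r`
-- for `fillCorner₁₂`.
grow : ∀ d e → suc (d + r) ≡ n → suc (e * 2 + c) ≡ m → d ≤ e * 2 → (d ≡ 1 → 0 < r) →
       Filled n m r c k → ContaminatingOfSize n m (e + k)
grow zero zero refl refl _ _ F = filledGrid F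
grow {c = c} {k = k} d (suc e) eqⁿ eqᵐ d≤ 1⇒ F =
  subst (ContaminatingOfSize _ _) (+-suc e k) (step d eqⁿ d≤ 1⇒ F)
  where
  shift : ∀ a b → 1 + (a + (2 + b)) ≡ 3 + (a + b)
  shift a b = cong suc (trans (+-suc a (suc b)) (cong suc (+-suc a b)))

  c′<m : 2 + c < _
  c′<m = subst (2 + c <_) eqᵐ (s≤s (s≤s (s≤s (m≤n+m c (e * 2)))))

  step : ∀ {r} d → suc (d + r) ≡ _ → d ≤ suc e * 2 → (d ≡ 1 → 0 < r) →
         Filled _ _ r c k → ContaminatingOfSize _ _ (e + suc k)
  step zero refl _ _ F = grow 0 e refl (trans (shift (e * 2) c) eqᵐ) z≤n (λ ())
    (addSeed ≤-refl (n≤1+n _) c′<m (λ cl → fillCorner₀₂ cl) F)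
  step {zero} 1 _ _ 1⇒ _ = contradiction (1⇒ refl) λ ()
  step {suc r} 1 refl _ _ F = grow 0 e refl (trans (shift (e * 2) c) eqᵐ) z≤n (λ ())
    (addSeed ≤-refl (n≤1+n _) c′<m (λ cl → fillCorner₁₂ cl) F)
  -- The new last row has index at least 2, so a later one-row advance is possible.
  step {r} (suc (suc d)) refl (s≤s (s≤s d≤)) _ F =
    grow d e (shift d r) (trans (shift (e * 2) c) eqᵐ) d≤ (λ _ → s≤s z≤n)
      (addSeed (s≤s (s≤s (s≤s (m≤n+m r d)))) (n≤1+n _) c′<m (λ cl → fillCorner₂₂ cl) F)

parity : ∀ a → (∃[ q ] a ≡ q * 2) ⊎ (∃[ q ] a ≡ suc (q * 2))
parity zero = inj₁ (0 , refl)
parity (suc a) with parity a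
... | inj₁ (q , refl) = inj₂ (q , refl)
... | inj₂ (q , refl) = inj₁ (suc q , refl)

⌊q*2/2⌋≡q : ∀ q → ⌊ q * 2 /2⌋ ≡ q
⌊q*2/2⌋≡q zero    = refl
⌊q*2/2⌋≡q (suc q) = cong suc (⌊q*2/2⌋≡q q)

⌈q*2/2⌉≡q : ∀ q → ⌈ q * 2 /2⌉ ≡ q
⌈q*2/2⌉≡q zero    = refl
⌈q*2/2⌉≡q (suc q) = cong suc (⌈q*2/2⌉≡q q)

-- From a single cell, only `r ≡ 1` would call for a one-row advance out of a one-row rectangle.
contaminatingOdd : ∀ r q → r ≢ 1 → r ≤ q * 2 → ContaminatingOfSize (suc r) (suc (q * 2)) (q + 1)
contaminatingOdd r q r≢1 r≤ =
  grow r q (cong suc (+-identityʳ r)) (cong suc (+-identityʳ (q * 2))) r≤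
    (λ r≡1 → contradiction r≡1 r≢1) filledCell

filled22 : Filled (2 + n) (2 + m) 1 1 2
filled22 = addSeed (s≤s (s≤s z≤n)) ≤-refl (s≤s (s≤s z≤n)) (λ cl → fillCorner cl) filledCell

-- Two seeds fill the first two columns, of one row or of two, so an even number of columns remains.
contaminatingEven : ∀ r q → r ≤ suc (q * 2) → ContaminatingOfSize (suc r) (suc q * 2) (q + 2)
contaminatingEven zero q _ =
  grow 0 q refl (cong suc (+-comm (q * 2) 1)) z≤n (λ ())
    (addSeed ≤-refl ≤-refl (s≤s (s≤s z≤n)) (λ cl → fillColumn cl) filledCell)
contaminatingEven (suc r) q (s≤s r≤) =
  grow r q (cong suc (+-comm r 1)) (cong suc (+-comm (q * 2) 1)) r≤ (λ _ → ≤-refl) filled22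

-- One extra seed is spent on the third column alone to make the number of remaining columns even.
contaminating2Odd : ∀ q → ContaminatingOfSize 2 (suc (suc q * 2)) (q + 3)
contaminating2Odd q =
  grow 0 q refl (cong suc (+-comm (q * 2) 2)) z≤n (λ ())
    (addSeed ≤-refl ≤-refl (s≤s (s≤s (s≤s z≤n))) (λ cl → fillColumn cl) filled22)

attainable : ∀ n m → 1 ≤ n → n ≤ m → (n ≡ 2 → ∃[ q ] m ≡ q * 2) →
             ContaminatingOfSize n m (⌊ m /2⌋ + 1)
attainable (suc r) m _ n≤m even with parity m
attainable (suc r) _ _ n≤m even | inj₁ (suc q , refl) =
  subst (ContaminatingOfSize _ _) (trans (+-suc q 1) (cong (λ h → suc h + 1) (sym (⌊q*2/2⌋≡q q))))
    (contaminatingEven r q (s≤s⁻¹ n≤m))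
attainable (suc r) _ _ n≤m even | inj₂ (q , refl) =
  subst (λ h → ContaminatingOfSize (suc r) (suc (q * 2)) (h + 1)) (sym (⌈q*2/2⌉≡q q))
    (contaminatingOdd r q (λ { refl → let q′ , eq = even refl in odd≢even q q′ eq }) (s≤s⁻¹ n≤m))
  where
  odd≢even : ∀ a b → suc (a * 2) ≢ b * 2
  odd≢even (suc a) (suc b) eq = odd≢even a b (suc-injective (suc-injective eq))

-- Lower bound: counting column classes

-- Each label picks an index of `xs`; the entry there determines the label, so the choice is
-- injective.
labels⇒≤ : ∀ {A : Set} (label : A → ℕ) (xs : List A) →
           (∀ {l} → l < k → ∃[ x ] x ∈ xs × label x ≡ l) → k ≤ length xs
labels⇒≤ label xs hit = injective⇒≤ {f = λ l → index (proj₁ (proj₂ (hit (toℕ<n l))))} injective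
  where
  injective : ∀ {l l′} → index (proj₁ (proj₂ (hit (toℕ<n l)))) ≡
                         index (proj₁ (proj₂ (hit (toℕ<n l′)))) → l ≡ l′
  injective {l} {l′} eq with hit (toℕ<n l) | hit (toℕ<n l′)
  ... | x , x∈ , a | y , y∈ , b = toℕ-injective (trans (sym a) (trans (cong label x≡y) b))
    where x≡y = trans (lookup-index x∈) (trans (cong (lookup xs) eq) (sym (lookup-index y∈)))

-- Every rule either has a source in the column of its target or has sources in the two columns
-- flanking it, one of which `paired` puts in `Q`. Tracing a derivation back within `Q` ends at a
-- seed.
seedIn : ∀ {S : List (Cell n m)} (Q : ℕ → Set) → (∀ j → Q (suc j) → Q j ⊎ Q (2 + j)) →
         C S u → Q (toℕ (proj₂ u)) → ∃[ s ] s ∈ S × Q (toℕ (proj₂ s))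
seedIn Q paired (initial u∈S) q = _ , u∈S , q
seedIn {u = u} {S = S} Q paired (spread {v = v} {w = w} rule p p′) q with back rule q
  where
  sandwiched : ∀ {a b d} → suc a ≡ b → suc b ≡ d → Q b → Q a ⊎ Q d
  sandwiched refl refl = paired _

  back : Contaminates v w u → Q (toℕ (proj₂ u)) → Q (toℕ (proj₂ v)) ⊎ Q (toℕ (proj₂ w))
  back (rule-a _ _ x y) = sandwiched x y
  back (rule-b _ _ x y) = sandwiched x y
  back (rule-c _ _)     = inj₁
  back (rule-d x y)     = sandwiched x y
  back (rule-e _ _)     = inj₂
  back (rule-f _ _)     = inj₂
  back (rule-g _ _)     = inj₁
  back (rule-h _ _)     = inj₁
... | inj₁ qv = seedIn Q paired p qv
... | inj₂ qw = seedIn Q paired p′ qw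

contaminated⇒seedIn : (∀ u → C {suc n} {m} S u) → (Q : ℕ → Set) →
                      (∀ j → Q (suc j) → Q j ⊎ Q (2 + j)) → (∃[ j ] j < m × Q j) →
                      ∃[ s ] s ∈ S × Q (toℕ (proj₂ s))
contaminated⇒seedIn full Q paired (j , j<m , q) =
  seedIn Q paired (full (zero , fromℕ< j<m)) (subst Q (sym (toℕ-fromℕ< j<m)) q)

-- The label classes of ⌈_/2⌉ are the columns 0 | 1 2 | 3 4 | …
⌈/2⌉-paired : ∀ l j → ⌈ suc j /2⌉ ≡ l → ⌈ j /2⌉ ≡ l ⊎ ⌈ 2 + j /2⌉ ≡ l
⌈/2⌉-paired l zero          eq = inj₂ eq
⌈/2⌉-paired l (suc zero)    eq = inj₁ eq
⌈/2⌉-paired l (suc (suc j)) refl = map (cong suc) (cong suc) (⌈/2⌉-paired _ j refl)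

⌈/2⌉-surjective : ∀ m l → 1 ≤ m → l ≤ ⌊ m /2⌋ → ∃[ j ] j < m × ⌈ j /2⌉ ≡ l
⌈/2⌉-surjective (suc m)             zero    _ _   = 0 , s≤s z≤n , refl
⌈/2⌉-surjective (suc (suc zero))    (suc zero) _ _ = 1 , ≤-refl , refl
⌈/2⌉-surjective (suc (suc zero))    (suc (suc l)) _ (s≤s ())
⌈/2⌉-surjective (suc (suc (suc m))) (suc l) _ (s≤s l≤) =
  let j , j<m , eq = ⌈/2⌉-surjective (suc m) l (s≤s z≤n) l≤
  in 2 + j , s≤s (s≤s j<m) , cong suc eq

halfLabelHit : ∀ {l} → 1 ≤ m → (∀ u → C {suc n} {m} S u) → l ≤ ⌊ m /2⌋ →
               ∃[ s ] s ∈ S × ⌈ toℕ (proj₂ s) /2⌉ ≡ l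
halfLabelHit {m = m} {l = l} 1≤m full l≤ =
  contaminated⇒seedIn full (λ j → ⌈ j /2⌉ ≡ l) (⌈/2⌉-paired l) (⌈/2⌉-surjective m l 1≤m l≤)

half+1≤seeds : ∀ n m → 1 ≤ n → n ≤ m → (S : List (Cell n m)) → (∀ u → C S u) →
               ⌊ m /2⌋ + 1 ≤ length S
half+1≤seeds (suc n) m _ n≤m S full = subst (_≤ length S) (+-comm 1 _)
  (labels⇒≤ (λ u → ⌈ toℕ (proj₂ u) /2⌉) S
    λ l< → halfLabelHit (≤-trans (s≤s z≤n) n≤m) full (s≤s⁻¹ l<))

-- Lower bound for two rows and an odd number of columns

-- The label classes of split p are the columns
-- 0 | 1 2 | … | 2p-1 2p | 2p+1 | 2p+2 2p+3 | …
split : ℕ → ℕ → ℕ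
split p       zero          = 0
split zero    (suc j)       = suc ⌈ j /2⌉
split (suc p) (suc zero)    = 1
split (suc p) (suc (suc j)) = suc (split p j)

split-single : ∀ p → split p (suc (p * 2)) ≡ suc p
split-single zero    = refl
split-single (suc p) = cong suc (split-single p)

-- The excluded class `suc p` is the lone column 2p+1, which contamination can enter from both
-- sides.
split-paired : ∀ p l j → l ≢ suc p → split p (suc j) ≡ l → split p j ≡ l ⊎ split p (2 + j) ≡ l
split-paired zero    l zero          l≢ eq   = contradiction (sym eq) l≢
split-paired zero    l (suc j)       _  refl = map (cong suc) (cong suc) (⌈/2⌉-paired _ j refl)
split-paired (suc p) l zero          _  eq   = inj₂ eq
split-paired (suc p) l (suc zero)    _  eq   = inj₁ eq
split-paired (suc p) l (suc (suc j)) l≢ refl =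
  map (cong suc) (cong suc) (split-paired p _ j (l≢ ∘ cong suc) refl)

split-surjective : ∀ p q l → p < q → l ≤ suc q → ∃[ j ] j < suc (q * 2) × split p j ≡ l
split-surjective p       q       zero    _ _ = 0 , s≤s z≤n , refl
split-surjective zero    q       (suc zero) p<q _ = 1 , s≤s (≤-trans p<q (m≤m*n q 2)) , refl
-- The even column of the class is chosen, since the last class has only that one inside the grid.
split-surjective zero    (suc q) (suc (suc l)) _ (s≤s (s≤s l≤)) =
  2 + l * 2 , s≤s (s≤s (s≤s (*-monoˡ-≤ 2 l≤))) , cong (2 +_) (⌊q*2/2⌋≡q l)
split-surjective (suc p) (suc q) (suc l) (s≤s p<q) (s≤s l≤) =
  let j , j< , eq = split-surjective p q l p<q l≤
  in 2 + j , s≤s (s≤s j<) , cong suc eq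

module _ {q : ℕ} {S : List (Cell 2 (suc (q * 2)))} (full : ∀ u → C S u) where

  -- Isolating the column of `s` as a class of its own gives `q + 2` classes; `s` accounts for the
  -- isolated one.
  oddSeed⇒≤ : ∀ {s} → s ∈ S → ∀ p → toℕ (proj₂ s) ≡ suc (p * 2) → q + 2 ≤ length S
  oddSeed⇒≤ {s} s∈S p odd = subst (_≤ length S) (+-comm 2 q) (labels⇒≤ (split p ∘ toℕ ∘ proj₂) S hit)
    where
    p<q : p < q
    p<q = *-cancelʳ-< 2 p q (s≤s⁻¹ (subst (_< _) odd (toℕ<n (proj₂ s))))

    hit : ∀ {l} → l < 2 + q → ∃[ u ] u ∈ S × split p (toℕ (proj₂ u)) ≡ l
    hit {l} l< with l ≟ suc p
    ... | yes refl = s , s∈S , trans (cong (split p) odd) (split-single p)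
    ... | no l≢    = contaminated⇒seedIn full (λ j → split p j ≡ l) (λ j → split-paired p l j l≢)
                       (split-surjective p q l p<q (s≤s⁻¹ l<))

  -- The seed `s` gets the fresh label `suc q`; its column class is still represented by `s′`.
  doubledColumn⇒≤ : ∀ {j} → (zero , j) ∈ S → (suc zero , j) ∈ S → q + 2 ≤ length S
  doubledColumn⇒≤ {j} s∈S s′∈S = subst (_≤ length S) (+-comm 2 q) (labels⇒≤ label S hit)
    where
    s s′ : Cell 2 (suc (q * 2))
    s  = zero , j
    s′ = suc zero , j

    isS? : ∀ u → Dec (u ≡ s)
    isS? u = ≡-dec _≟ᶠ_ _≟ᶠ_ u s

    label : Cell 2 (suc (q * 2)) → ℕ
    label u with isS? u
    ... | yes _ = suc q
    ... | no  _ = ⌈ toℕ (proj₂ u) /2⌉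

    label-s : label s ≡ suc q
    label-s with isS? s
    ... | yes _  = refl
    ... | no s≢s = contradiction refl s≢s

    label-other : ∀ {u} → u ≢ s → label u ≡ ⌈ toℕ (proj₂ u) /2⌉
    label-other {u} u≢s with isS? u
    ... | yes u≡s = contradiction u≡s u≢s
    ... | no _    = refl

    hit : ∀ {l} → l < 2 + q → ∃[ u ] u ∈ S × label u ≡ l
    hit {l} (s≤s l≤) with m≤n⇒m<n∨m≡n l≤
    ... | inj₂ refl = s , s∈S , label-s
    ... | inj₁ (s≤s l≤q) with halfLabelHit (s≤s z≤n) full (subst (l ≤_) (sym (⌈q*2/2⌉≡q q)) l≤q)
    ...   | u , u∈S , eq with isS? u
    ...     | yes refl = s′ , s′∈S , trans (label-other {s′} λ ()) eq
    ...     | no u≢s   = u , u∈S , trans (label-other u≢s) eq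

-- With seeds only in even columns, at most one in each, contamination of two
-- rows stops after filling the odd columns whose neighbours agree.
module _ {S : List (Cell 2 m)}
         (noOdd : ∀ {s} → s ∈ S → ∀ p → toℕ (proj₂ s) ≢ suc (p * 2))
         (noDouble : ∀ {j} → (zero , j) ∈ S → (suc zero , j) ∈ S → ⊥) where

  Adjacent : Fin m → Fin m → Set
  Adjacent j j′ = j′ ⋖ j ⊎ j ⋖ j′

  -- The invariant of spreading. `Adjacent` ranges over columns of the grid only, so a border cell
  -- has at most one neighbour to check.
  Stuck : Cell 2 m → Set
  Stuck (i , j) = (i , j) ∈ S ⊎ (∀ {j′} → Adjacent j j′ → (i , j′) ∈ S)

  noDistinct : ∀ {i i′ : Fin 2} {j} → i ≢ i′ → (i , j) ∈ S → (i′ , j) ∈ S → ⊥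
  noDistinct {zero}     {zero}     i≢i′ = contradiction refl i≢i′
  noDistinct {zero}     {suc zero} _ p p′ = noDouble p p′
  noDistinct {suc zero} {zero}     _ p p′ = noDouble p′ p
  noDistinct {suc zero} {suc zero} i≢i′ = contradiction refl i≢i′

  noSuccessive : ∀ {i i′ : Fin 2} {j j′} → j ⋖ j′ → (i , j) ∈ S → (i′ , j′) ∈ S → ⊥
  noSuccessive {j = j} j⋖j′ p p′ with parity (toℕ j)
  ... | inj₁ (q , even) = noOdd p′ q (trans (sym j⋖j′) (cong suc even))
  ... | inj₂ (q , odd)  = noOdd p q odd

  noAdjacent : ∀ {i i′ : Fin 2} {j j′} → Adjacent j j′ → (i , j) ∈ S → (i′ , j′) ∈ S → ⊥
  noAdjacent (inj₁ j′⋖j) p p′ = noSuccessive j′⋖j p′ p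
  noAdjacent (inj₂ j⋖j′) p p′ = noSuccessive j⋖j′ p p′

  ⋖⇒≢ : ∀ {i i′ : Fin n} → i ⋖ i′ → i ≢ i′
  ⋖⇒≢ eq refl = 1+n≢n eq

  swap : ∀ {j j′} → Adjacent j j′ → Adjacent j′ j
  swap (inj₁ a) = inj₂ a
  swap (inj₂ a) = inj₁ a

  -- If `(i , j′)` is no seed, its neighbour `(i , j)` is one. Otherwise the second source yields
  -- either seeds in adjacent columns, one of them odd, or two seeds in column `j′`.
  stuck-corner : ∀ {i i′ j j′} → i ≢ i′ → Adjacent j j′ →
                 Stuck (i , j′) → Stuck (i′ , j) → Stuck (i , j)
  stuck-corner i≢i′ a (inj₂ p) _        = inj₁ (p (swap a))
  stuck-corner i≢i′ a (inj₁ p) (inj₁ q) = contradiction p (noAdjacent a q)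
  stuck-corner i≢i′ a (inj₁ p) (inj₂ q) = contradiction (q a) (noDistinct i≢i′ p)

  noThreeRows : ∀ {i i′ i″ : Fin 2} → i ⋖ i′ → i′ ⋖ i″ → ⊥
  noThreeRows {zero}     {suc zero} {suc zero} _ ()
  noThreeRows {suc zero} {suc zero} ()

  stuck-spread : Contaminates v w u → Stuck v → Stuck w → Stuck u
  stuck-spread (rule-a x y _ _) = contradiction y (noThreeRows x)
  stuck-spread (rule-b x y _ _) = contradiction y (noThreeRows x)
  stuck-spread (rule-c x y)     = contradiction y (noThreeRows x)
  stuck-spread (rule-d x y) (inj₂ p) _        = inj₁ (p (inj₂ x))
  stuck-spread (rule-d x y) (inj₁ _) (inj₂ q) = inj₁ (q (inj₁ y))
  -- Any adjacent column has the number of one of the two sources, hence equals it.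
  stuck-spread (rule-d x y) (inj₁ p) (inj₁ q) = inj₂ λ
    { (inj₁ a) → subst (λ j → (_ , j) ∈ S) (toℕ-injective (suc-injective (trans x (sym a)))) p
    ; (inj₂ a) → subst (λ j → (_ , j) ∈ S) (toℕ-injective (trans (sym y) a)) q
    }
  stuck-spread (rule-e x y) p q = stuck-corner (⋖⇒≢ x ∘ sym) (inj₁ y) p q
  stuck-spread (rule-f x y) p q = stuck-corner (⋖⇒≢ x) (inj₁ y) p q
  stuck-spread (rule-g x y) p q = stuck-corner (⋖⇒≢ x) (inj₂ y) q p
  stuck-spread (rule-h x y) p q = stuck-corner (⋖⇒≢ x ∘ sym) (inj₂ y) q p

  C⇒Stuck : C S u → Stuck u
  C⇒Stuck (initial u∈S)     = inj₁ u∈S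
  C⇒Stuck (spread rule p q) = stuck-spread rule (C⇒Stuck p) (C⇒Stuck q)

  -- Column 0 cannot hold two seeds, and a stuck non-seed there forces a seed in column 1, which is
  -- odd.
  ¬fullyContaminated : 2 ≤ m → (∀ u → C S u) → ⊥
  ¬fullyContaminated (s≤s (s≤s _)) full
    with C⇒Stuck (full (zero , zero)) | C⇒Stuck (full (suc zero , zero))
  ... | inj₁ p | inj₁ q = noDouble p q
  ... | inj₂ p | _      = noOdd (p {suc zero} (inj₂ refl)) 0 refl
  ... | inj₁ _ | inj₂ q = noOdd (q {suc zero} (inj₂ refl)) 0 refl

-- Decidability of the bound allows arguing by contradiction: too few seeds rule out both an odd
-- seed and a doubled column, without a search through `S`.
twoRows⇒≤ : ∀ q (S : List (Cell 2 (suc (suc q * 2)))) → (∀ u → C S u) → suc q + 2 ≤ length S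
twoRows⇒≤ q S full = decidable-stable (_ ≤? _) λ few →
  ¬fullyContaminated (λ s∈S p odd → few (oddSeed⇒≤ full s∈S p odd))
                     (λ s∈S s′∈S → few (doubledColumn⇒≤ full s∈S s′∈S))
                     (s≤s (s≤s z≤n)) full

-- Assembling the cases

generic : ∀ n m → 1 ≤ n → n ≤ m → (n ≡ 2 → ∃[ q ] m ≡ q * 2) →
          IsPowerContaminationNumber n m (⌊ m /2⌋ + 1)
generic n m 1≤n n≤m even = record
  { attained = attainable n m 1≤n n≤m even
  ; minimal  = λ S isSet → half+1≤seeds n m 1≤n n≤m S (IsContaminatingSet.contaminate isSet)
  }

exceptional : ∀ q → IsPowerContaminationNumber 2 (suc (suc q * 2)) (suc q + 2)
exceptional q = record
  { attained = subst (ContaminatingOfSize _ _) (+-suc q 2) (contaminating2Odd q)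
  ; minimal  = λ S isSet → twoRows⇒≤ q S (IsContaminatingSet.contaminate isSet)
  }

theorem1 : ∀ (n m : ℕ) → 1 ≤ n → n ≤ m →
    IsPowerContaminationNumber n m
    (if does ((n ≟ 2) ×-dec (m % 2 ≟ 1))
    then ⌈ m /2⌉ + 1
    else ⌊ m /2⌋ + 1)
theorem1 1 m 1≤n n≤m = generic 1 m 1≤n n≤m λ ()
theorem1 (suc (suc (suc n))) m 1≤n n≤m = generic (3 + n) m 1≤n n≤m λ ()
theorem1 2 m 1≤n n≤m with parity m
theorem1 2 _ 1≤n n≤m | inj₁ (q , refl) rewrite m*n%n≡0 q 2 {{_}} =
  generic 2 (q * 2) 1≤n n≤m λ _ → q , refl
-- Here `m` would be 1, less than the two rows.
theorem1 2 _ 1≤n (s≤s ()) | inj₂ (zero , refl)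
theorem1 2 _ 1≤n n≤m | inj₂ (suc q , refl) rewrite [m+kn]%n≡m%n 1 (suc q) 2 {{_}} | ⌊q*2/2⌋≡q q =
  subst (IsPowerContaminationNumber 2 _) (cong suc (+-suc q 1)) (exceptional q)
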